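{- Let $\kappa\in\mathbb{N}$ be even and let $G$ be a $\kappa$-connected graph of order $n$. (a) If $I$ is a nondecreasing distance-based topological index, then \[ I(G)\le I(C_n^{\kappa/2}). \] (b) If $\kappa=2$ and $I$ is an increasing distance-based topological index, then \[ I(G)\le I(C_n^{\kappa/2}), \] with equality if and only if $G$ is a cycle. (c) Corresponding statements hold if $I$ is nonincreasing or decreasing: if $I$ is a nonincreasing distance-based topological index, then $I(G)\ge I(C_n^{\kappa/2})$; and if $\kappa=2$ and $I$ is a decreasing distance-based topological index, then $I(G)\ge I(C_n^{\kappa/2})$, with equality if and only if $G$ is a cycle.
   Context: All graphs are finite and simple, and $\mathbb{N}$ denotes the positive integers. The order of a graph is its number of vertices. A graph $G$ is $k$-connected if it has more than $k$ vertices and $G-S$ is connected whenever $S$ is a set of fewer than $k$ vertices. $C_n$ is the cycle on $n$ vertices. The $k$-th power $G^k$ of a graph $G$ is the graph on the same vertex set in which two distinct vertices are adjacent if their distance in $G$ is at most $k$. For a connected graph $G$, $d_G(u,v)$ is the usual shortest-path distance. The distance sequence $\mathcal{D}(G)$ of a connected graph $G$ is the nondecreasing sequence (of length $\binom{n}{2}$ if $G$ has order $n$) of the distances between all unordered pairs of distinct vertices of $G$, with repetitions. A topological index $I$, assigning a real number to each connected graph, is distance-based if it can be expressed in the form $I(G)=g(\mathcal{D}(G))$, where $g$ is a real-valued function defined on the set of all finite sequences of positive integers. It is called increasing (decreasing, nonincreasing, nondecreasing) if $g$, when restricted to sequences of any fixed length, is increasing (decreasing, nonincreasing, nondecreasing)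 in every coordinate, where increasing and decreasing are meant strictly. -}

module Defs where

open import Data.Fin using (Fin; zero; suc; toℕ; inject₁) renaming (_<_ to _<ᶠ_)
open import Data.Fin.Properties using (any?; toℕ-inject₁)
  renaming (_≟_ to _≟ᶠ_; _<?_ to _<ᶠ?_; <⇒≢ to <ᶠ⇒≢)
open import Data.Fin.Induction using (<-weakInduction)
open import Data.Fin.Subset using (Subset; _∉_; ∣_∣) renaming (⊥ to ∅)
open import Data.Fin.Subset.Properties using (∉⊥; ∣⊥∣≡0)
open import Data.List using (List; _∷_; _++_; map; mapMaybe; concatMap; allFin)
import Data.List.Sort as Sort
open import Data.Maybe using () renaming (map to mapᵐ)
open import Data.Nat
open import Data.Nat.Properties
open import Data.Nat.Divisibility using (_∣_; ∣⇒≤)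
open import Data.Nat.DivMod using (_/_; m≥n⇒m/n>0)
open import Data.Product using (∃; ∃₂; ∃-syntax; Σ-syntax; _×_; _,_; proj₁; proj₂)
open import Data.Rational using (ℚ) renaming (_<_ to _<ᵠ_)
open import Data.Sum using (_⊎_; inj₁; inj₂; swap)
open import Function using (_∘_)
open import Function.Bundles using (_↔_; _⇔_; module Inverse)
open import Level using (0ℓ)
open import Relation.Binary.Bundles using (DecTotalOrder)
open import Relation.Binary.Core using (Rel)
import Relation.Binary.Construct.On as On
open import Relation.Binary.PropositionalEquality
open import Relation.Nullary using (¬_; Dec; yes; no; contradiction)
open import Relation.Nullary.Decidable using (map′; _×-dec_; _⊎-dec_; ¬?; dec⇒maybe)

-- Two-sided Dedekind cuts.
record ℝ : Set₁ where
  field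
    Lower Upper   : ℚ → Set
    lowerNonempty : ∃ Lower
    upperNonempty : ∃ Upper
    lowerRounded  : ∀ q → Lower q ⇔ (∃[ r ] q <ᵠ r × Lower r)
    upperRounded  : ∀ q → Upper q ⇔ (∃[ r ] r <ᵠ q × Upper r)
    disjoint      : ∀ q → ¬ (Lower q × Upper q)
    located       : ∀ q r → q <ᵠ r → Lower q ⊎ Upper r

open ℝ

infix 4 _≤ᴿ_ _≥ᴿ_ _<ᴿ_ _>ᴿ_ _≃ᴿ_

_≤ᴿ_ _≥ᴿ_ _<ᴿ_ _>ᴿ_ _≃ᴿ_ : Rel ℝ 0ℓ
x ≤ᴿ y = ∀ q → Lower x q → Lower y q
x ≥ᴿ y = y ≤ᴿ x
x <ᴿ y = ∃[ q ] Upper x q × Lower y q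
x >ᴿ y = y <ᴿ x
-- Equality of real numbers: without quotients, equal cuts need not be
-- propositionally equal.
x ≃ᴿ y = x ≤ᴿ y × y ≤ᴿ x

record Graph (V : Set) : Set₁ where
  field
    Adj        : V → V → Set
    adj?       : ∀ u v → Dec (Adj u v)
    adj-sym    : ∀ {u v} → Adj u v → Adj v u
    adj-irrefl : ∀ {v} → ¬ Adj v v

open Graph public

_≅_ : ∀ {V W} → Graph V → Graph W → Set
_≅_ {V} {W} G H =
  Σ[ f ∈ V ↔ W ] ∀ u v → Adj G u v ⇔ Adj H (Inverse.to f u) (Inverse.to f v)

infixr 5 _∷_

data Walk {V} (G : Graph V) : V → V → ℕ → Set where
  []  : ∀ {v} → Walk G v v 0
  _∷_ : ∀ {u v w k} → Adj G u v → Walk G v w k → Walk G u w (suc k)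

Connected : ∀ {V} → Graph V → Set
Connected G = ∀ u v → ∃ (Walk G u v)

infixl 6 _-ᵍ_

-- Proofs of v ∉ S are definitionally equal, so the type ∃ (_∉ S) has each
-- vertex outside S exactly once.
_-ᵍ_ : ∀ {n} → Graph (Fin n) → (S : Subset n) → Graph (∃ (_∉ S))
G -ᵍ S = record
  { Adj        = λ u v → Adj G (proj₁ u) (proj₁ v)
  ; adj?       = λ u v → adj? G (proj₁ u) (proj₁ v)
  ; adj-sym    = adj-sym G
  ; adj-irrefl = adj-irrefl G
  }

κ-Connected : ℕ → ∀ {n} → Graph (Fin n) → Set
κ-Connected κ {n} G = κ < n × (∀ (S : Subset n) → ∣ S ∣ < κ → Connected (G -ᵍ S))

-- A shortest walk is a path, so this is the usual shortest-path distance.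
IsDistance : ∀ {V} → Graph V → V → V → ℕ → Set
IsDistance G u v d = Walk G u v d × (∀ k → Walk G u v k → d ≤ k)

walk? : ∀ {n} (G : Graph (Fin n)) u v k → Dec (Walk G u v k)
walk? G u v zero = map′ (λ { refl → [] }) (λ { [] → refl }) (u ≟ᶠ v)
walk? G u v (suc k) =
  map′ (λ { (w , a , p) → a ∷ p }) (λ { (a ∷ p) → _ , a , p })
       (any? λ w → adj? G u w ×-dec walk? G w v k)

least : ∀ {P : ℕ → Set} → (∀ k → Dec (P k)) → ∀ {m} → P m →
        ∃[ d ] P d × (∀ k → P k → d ≤ k)
least P? {zero} p = 0 , p , λ _ _ → z≤n
least {P} P? {suc m} p with P? 0
... | yes p₀ = 0 , p₀ , λ _ _ → z≤n
... | no ¬p₀ with least {P ∘ suc} (P? ∘ suc) {m} p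
...   | d , pd , min = suc d , pd ,
        λ { zero p₀ → contradiction p₀ ¬p₀ ; (suc k) pk → s≤s (min k pk) }

distance : ∀ {n} (G : Graph (Fin n)) {u v} → ∃ (Walk G u v) → ∃ (IsDistance G u v)
distance G {u} {v} (_ , p) = least (walk? G u v) p

dist : ∀ {n} (G : Graph (Fin n)) → Connected G → Fin n → Fin n → ℕ
dist G c u v = proj₁ (distance G (c u v))

dist-nonZero : ∀ {n} (G : Graph (Fin n)) (c : Connected G) {u v} → u ≢ v →
               NonZero (dist G c u v)
dist-nonZero G c {u} {v} u≢v with distance G (c u v)
... | zero  , [] , _ = contradiction refl u≢v
... | suc _ , _      = _

-- Vertices in different components have no distance, so they are never
-- adjacent in a power.
infixl 8 _^ᵍ_

_^ᵍ_ : ∀ {n} → Graph (Fin n) → ℕ → Graph (Fin n)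
G ^ᵍ k = record
  { Adj        = λ u v → u ≢ v × Near u v
  ; adj?       = λ u v → ¬? (u ≟ᶠ v) ×-dec near? u v
  ; adj-sym    = λ { (u≢v , d , (p , min) , d≤k) →
               u≢v ∘ sym , d , (rev p , λ j → min j ∘ rev) , d≤k }
  ; adj-irrefl = λ { (v≢v , _) → v≢v refl }
  }
  where
  Near : _ → _ → Set
  Near u v = ∃[ d ] IsDistance G u v d × d ≤ k

  near? : ∀ u v → Dec (Near u v)
  near? u v = map′
    (λ { (_ , s≤s j≤k , p) → let d , isd = distance G (_ , p) in
                             d , isd , ≤-trans (proj₂ isd _ p) j≤k })
    (λ { (d , (p , _) , d≤k) → d , s≤s d≤k , p })
    (anyUpTo? (walk? G u v) (suc k))

  snoc : ∀ {u v w j} → Walk G u v j → Adj G v w → Walk G u w (suc j)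
  snoc []      a = a ∷ []
  snoc (b ∷ p) a = b ∷ snoc p a

  rev : ∀ {u v j} → Walk G u v j → Walk G v u j
  rev []      = []
  rev (a ∷ p) = snoc (rev p) (adj-sym G a)

Next : ∀ {n} → Fin n → Fin n → Set
Next {n} i j = toℕ j ≡ suc (toℕ i) ⊎ (suc (toℕ i) ≡ n × toℕ j ≡ 0)

next? : ∀ {n} (i j : Fin n) → Dec (Next i j)
next? {n} i j = (toℕ j ≟ suc (toℕ i)) ⊎-dec ((suc (toℕ i) ≟ n) ×-dec (toℕ j ≟ 0))

-- The cycle on n vertices when 3 ≤ n; the values at n < 3 are complete
-- graphs and are not regarded as cycles.
C : ∀ n → Graph (Fin n)
C n = record
  { Adj        = λ i j → i ≢ j × (Next i j ⊎ Next j i)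
  ; adj?       = λ i j → ¬? (i ≟ᶠ j) ×-dec (next? i j ⊎-dec next? j i)
  ; adj-sym    = λ { (i≢j , a) → i≢j ∘ sym , swap a }
  ; adj-irrefl = λ { (v≢v , _) → v≢v refl }
  }

IsCycle : ∀ {n} → Graph (Fin n) → Set
IsCycle {n} G = 3 ≤ n × G ≅ C n

ℕ⁺ : Set
ℕ⁺ = ∃ NonZero

_≤⁺_ _<⁺_ : Rel ℕ⁺ 0ℓ
a ≤⁺ b = proj₁ a ≤ proj₁ b
a <⁺ b = proj₁ a < proj₁ b

ℕ⁺-decTotalOrder : DecTotalOrder 0ℓ 0ℓ 0ℓ
ℕ⁺-decTotalOrder = On.decTotalOrder ≤-decTotalOrder (proj₁ {B = NonZero})

unorderedPairs : ∀ n → List (∃₂ λ (u v : Fin n) → u <ᶠ v)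
unorderedPairs n =
  concatMap (λ u → mapMaybe (λ v → mapᵐ (λ u<v → u , v , u<v) (dec⇒maybe (u <ᶠ? v)))
                            (allFin n))
            (allFin n)

distanceSequence : ∀ {n} (G : Graph (Fin n)) → Connected G → List ℕ⁺
distanceSequence {n} G c =
  Sort.sort ℕ⁺-decTotalOrder
    (map (λ { (u , v , u<v) → dist G c u v , dist-nonZero G c (<ᶠ⇒≢ u<v) })
         (unorderedPairs n))

record ConnectedGraph : Set₁ where
  constructor ⟨_,_⟩
  field
    {order}   : ℕ
    graph     : Graph (Fin order)
    connected : Connected graph

open ConnectedGraph public

𝒟 : ConnectedGraph → List ℕ⁺
𝒟 G = distanceSequence (graph G) (connected G)

Index : Set₁
Index = ConnectedGraph → ℝ

_ExpressedBy_ : Index → (List ℕ⁺ → ℝ) → Set₁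
I ExpressedBy g = ∀ G → I G ≃ᴿ g (𝒟 G)

InEveryCoordinate : Rel ℕ⁺ 0ℓ → Rel ℝ 0ℓ → (List ℕ⁺ → ℝ) → Set
InEveryCoordinate R S g =
  ∀ xs ys {a b} → R a b → S (g (xs ++ a ∷ ys)) (g (xs ++ b ∷ ys))

Nondecreasing Nonincreasing Increasing Decreasing : Index → Set₁
Nondecreasing I = ∃[ g ] I ExpressedBy g × InEveryCoordinate _≤⁺_ _≤ᴿ_ g
Nonincreasing I = ∃[ g ] I ExpressedBy g × InEveryCoordinate _≤⁺_ _≥ᴿ_ g
Increasing    I = ∃[ g ] I ExpressedBy g × InEveryCoordinate _<⁺_ _<ᴿ_ g
Decreasing    I = ∃[ g ] I ExpressedBy g × InEveryCoordinate _<⁺_ _>ᴿ_ g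

κ-connected⇒connected : ∀ {κ n} {G : Graph (Fin n)} → 0 < κ →
                        κ-Connected κ G → Connected G
κ-connected⇒connected {n = n} {G} 0<κ (_ , conn) u v =
  let k , p = conn ∅ (subst (_< _) (sym (∣⊥∣≡0 n)) 0<κ) (u , ∉⊥) (v , ∉⊥)
  in  k , forget p
  where
  forget : ∀ {x y k} → Walk (G -ᵍ ∅) x y k → Walk G (proj₁ x) (proj₁ y) k
  forget []      = []
  forget (a ∷ p) = a ∷ forget p

private
  append : ∀ {V} {G : Graph V} {u v w j k} →
           Walk G u v j → Walk G v w k → Walk G u w (j + k)
  append []      q = q
  append (a ∷ p) q = a ∷ append p q

  reverse : ∀ {V} {G : Graph V} {u v k} → Walk G u v k → ∃ (Walk G v u)
  reverse []              = 0 , []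
  reverse {G = G} (a ∷ p) = _ , append (proj₂ (reverse p)) (adj-sym G a ∷ [])

C-connected : ∀ n → Connected (C n)
C-connected (suc n) u v = _ , append (proj₂ (reverse (proj₂ (from0 u)))) (proj₂ (from0 v))
  where
  inject₁≢suc : ∀ {m} (i : Fin m) → inject₁ i ≢ suc i
  inject₁≢suc i eq = 1+n≢n (trans (sym (cong toℕ eq)) (toℕ-inject₁ i))

  from0 : ∀ i → ∃ (Walk (C (suc n)) zero i)
  from0 = <-weakInduction _ (0 , []) λ i (k , p) →
    _ , append p ((inject₁≢suc i , inj₁ (inj₁ (cong suc (sym (toℕ-inject₁ i))))) ∷ [])

^-connected : ∀ {n k} {G : Graph (Fin n)} → 0 < k → Connected G → Connected (G ^ᵍ k)
^-connected {k = k} {G} 0<k c u v = _ , lift (proj₂ (c u v))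
  where
  adj-^ : ∀ {x y} → Adj G x y → Adj (G ^ᵍ k) x y
  adj-^ {x} {y} a = x≢y , 1 , (a ∷ [] , 1≤) , 0<k
    where
    x≢y : x ≢ y
    x≢y refl = adj-irrefl G a
    1≤ : ∀ j → Walk G x y j → 1 ≤ j
    1≤ zero    [] = contradiction refl x≢y
    1≤ (suc j) _  = s≤s z≤n

  lift : ∀ {x y j} → Walk G x y j → Walk (G ^ᵍ k) x y j
  lift []      = []
  lift (a ∷ p) = adj-^ a ∷ lift p

C^-connected : ∀ n {κ} .{{_ : NonZero κ}} → 2 ∣ κ → Connected (C n ^ᵍ (κ / 2))
C^-connected n 2∣κ = ^-connected (m≥n⇒m/n>0 (∣⇒≤ 2∣κ)) (C-connected n)

{-# OPTIONS --safe #-}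

-- In a κ-connected graph every distance layer around a vertex, except the outermost,
-- is a cut and so has at least κ vertices. Hence a ball of radius i has at least
-- min(n, 1 + κ i) vertices, while in the (κ/2)-th power of the n-cycle it has at most
-- that many. Summing over the centres, for every i at least as many pairs are at
-- distance at most i in the graph as in the power of the cycle, so the sorted
-- distance sequence is dominated coordinatewise. If κ = 2 and the sequences agree, all
-- balls of radius 1 have three vertices, and a connected 2-regular graph is a cycle.
module Submission where

open import Defs
open import Data.Bool using (if_then_else_)
open import Data.Empty using (⊥-elim)
open import Data.Fin using (Fin; zero; suc; toℕ; fromℕ; fromℕ<; inject₁) renaming (_<_ to _<ᶠ_)
open import Data.Fin.Properties
  using (any?; all?; toℕ-inject₁; toℕ-injective; toℕ-fromℕ; toℕ-fromℕ<; toℕ<n; ¬∀⟶∃¬;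
         pigeonhole; injective⇒≤)
  renaming (_≟_ to _≟ᶠ_; _<?_ to _<ᶠ?_; <-cmp to <ᶠ-cmp)
open import Data.Fin.Subset using (Subset; _∉_; ∣_∣)
open import Data.List
  using (List; []; _∷_; [_]; _++_; map; mapMaybe; concatMap; tabulate; length)
open import Data.List.Properties using (map-++; map-∘; length-map; ++-assoc)
open import Data.List.Membership.Propositional using (_∈_)
open import Data.List.Membership.DecPropositional using (_∈?_)
open import Data.List.Relation.Binary.Permutation.Propositional.Properties
  using (map⁺; ↭-length)
open import Data.List.Relation.Binary.Pointwise using (Pointwise; []; _∷_)
open import Data.List.Relation.Unary.All as All using (All; []; _∷_)
open import Data.List.Relation.Unary.Any using (here; there)
open import Data.List.Relation.Unary.Linked.Properties using (Linked⇒AllPairs)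
open import Data.List.Relation.Unary.AllPairs using (AllPairs; []; _∷_)
import Data.List.Sort as Sort
open import Data.Maybe using (Maybe; just; nothing; maybe) renaming (map to mapᵐ)
open import Data.Nat
open import Data.Nat.DivMod using (_/_; m/n*n≡m)
open import Data.Nat.Divisibility using (_∣_)
open import Data.Nat.GeneralisedArithmetic using (iterate)
import Data.Nat.ListAction as ListAction
open import Data.Nat.ListAction.Properties using (sum-++; sum-↭)
open import Data.Nat.Properties
open import Algebra.Properties.Semiring.Sum +-*-semiring
  using (sum; sum-syntax; sum-cong-≗; sum-replicate-zero; ∑-distrib-+; ∑-comm; sum-permute; *-distribʳ-sum)
open import Data.Product using (∃; ∃₂; ∃-syntax; _×_; _,_; proj₁; proj₂)
open import Data.Rational using () renaming (_<?_ to _<ᵠ?_; _≤_ to _≤ᵠ_)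
import Data.Rational.Properties as ℚ
open import Data.Sum using (_⊎_; inj₁; inj₂; [_,_]′)
open import Data.Unit using (tt)
open import Data.Vec using () renaming (tabulate to tabulateᵛ)
open import Data.Vec.Properties using (lookup∘tabulate; lookup⇒[]=; []=⇒lookup)
open import Function using (_∘_; id; flip; _⇔_; mk⇔; mk↔ₛ′; Equivalence; Inverse)
open import Level using (0ℓ)
open import Relation.Binary.Core using (Rel)
open import Relation.Binary.Definitions using (Transitive; tri<; tri≈; tri>)
open import Relation.Binary.PropositionalEquality hiding ([_])
open import Relation.Nullary using (¬_; Dec; yes; no; does; contradiction)
open import Relation.Nullary.Decidable
  using (_×-dec_; _⊎-dec_; ¬?; dec-true; dec-false; dec⇒maybe; decidable-stable)
open import Relation.Unary using (Pred; Decidable; _⊆_)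
open import Relation.Unary.Properties using (_∪?_)

open ℝ

-- Real numbers

-- The separating rational `q` lies in the upper cut of `x`, so disjointness keeps the lower cut of
-- `x` below `q`; and `q` lies in the lower cut of `y`, which roundedness closes downwards.
<ᴿ⇒≤ᴿ : ∀ {x y} → x <ᴿ y → x ≤ᴿ y
<ᴿ⇒≤ᴿ {x} {y} (q , xUq , yLq) r xLr with r <ᵠ? q
... | yes r<q = Equivalence.from (lowerRounded y r) (q , r<q , yLq)
... | no  r≮q = contradiction (lower-closed (ℚ.≮⇒≥ r≮q) , xUq) (disjoint x q)
  where
  lower-closed : q ≤ᵠ r → Lower x q
  lower-closed q≤r with Equivalence.to (lowerRounded x r) xLr
  ... | s , r<s , xLs =
    Equivalence.from (lowerRounded x q) (s , ℚ.≤-<-trans q≤r r<s , xLs)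

<ᴿ-trans : Transitive _<ᴿ_
<ᴿ-trans {x} {y} {z} x<y (q , yUq , zLq) =
  let r , xUr , yLr = x<y
  in  r , xUr , <ᴿ⇒≤ᴿ {y} {z} (q , yUq , zLq) r yLr

<ᴿ⇒≱ᴿ : ∀ {x y} → x <ᴿ y → ¬ (y ≤ᴿ x)
<ᴿ⇒≱ᴿ {x} (q , xUq , yLq) y≤x = disjoint x q (y≤x q yLq , xUq)

≤ᴿ-trans : Transitive _≤ᴿ_
≤ᴿ-trans x≤y y≤z q = y≤z q ∘ x≤y q

≃ᴿ-sym : ∀ {x y} → x ≃ᴿ y → y ≃ᴿ x
≃ᴿ-sym (x≤y , y≤x) = y≤x , x≤y

≃ᴿ-trans : Transitive _≃ᴿ_
≃ᴿ-trans {x} {y} {z} (x≤y , y≤x) (y≤z , z≤y) =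
  ≤ᴿ-trans {x} {y} {z} x≤y y≤z , ≤ᴿ-trans {z} {y} {x} z≤y y≤x

-- Monotonicity in every coordinate

ℕ⁺-≡ : {a b : ℕ⁺} → proj₁ a ≡ proj₁ b → a ≡ b
ℕ⁺-≡ {suc _ , _} {suc _ , _} refl = refl

pointwise-antisym : ∀ {xs ys} → Pointwise _≤⁺_ xs ys → Pointwise _≤⁺_ ys xs → xs ≡ ys
pointwise-antisym []           []           = refl
pointwise-antisym (x≤y ∷ x≤ys) (y≤x ∷ y≤xs) =
  cong₂ _∷_ (ℕ⁺-≡ (≤-antisym x≤y y≤x)) (pointwise-antisym x≤ys y≤xs)

module _ (S : Rel ℝ 0ℓ) (S-trans : Transitive S) (g : List ℕ⁺ → ℝ)
         (g-mono : InEveryCoordinate _<⁺_ S g) where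

  -- Entries are exchanged one at a time and the changes compose by transitivity. `S` may be strict,
  -- hence not reflexive, so equality of the lists covers the case where nothing changes.
  ≡⊎monotone : ∀ {xs ys} → Pointwise _≤⁺_ xs ys → xs ≡ ys ⊎ S (g xs) (g ys)
  ≡⊎monotone = go []
    where
    -- `ws` holds the entries in front of the current one, already exchanged.
    go : ∀ ws {xs ys} → Pointwise _≤⁺_ xs ys → xs ≡ ys ⊎ S (g (ws ++ xs)) (g (ws ++ ys))
    go ws [] = inj₁ refl
    go ws {x ∷ xs} {y ∷ ys} (x≤y ∷ xs≤ys) = combine (m≤n⇒m<n∨m≡n x≤y) tail-step
      where
      tail-step : xs ≡ ys ⊎ S (g (ws ++ y ∷ xs)) (g (ws ++ y ∷ ys))
      tail-step with go (ws ++ [ y ]) xs≤ys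
      ... | inj₁ eq = inj₁ eq
      ... | inj₂ s  = inj₂ (subst₂ (λ as bs → S (g as) (g bs))
                                   (++-assoc ws [ y ] xs) (++-assoc ws [ y ] ys) s)

      combine : x <⁺ y ⊎ proj₁ x ≡ proj₁ y → xs ≡ ys ⊎ S (g (ws ++ y ∷ xs)) (g (ws ++ y ∷ ys)) →
                x ∷ xs ≡ y ∷ ys ⊎ S (g (ws ++ x ∷ xs)) (g (ws ++ y ∷ ys))
      combine (inj₁ x<y) (inj₁ refl) = inj₂ (g-mono ws xs x<y)
      combine (inj₁ x<y) (inj₂ s)    = inj₂ (S-trans (g-mono ws xs x<y) s)
      combine (inj₂ x≡y) (inj₁ refl) = inj₁ (cong (_∷ xs) (ℕ⁺-≡ x≡y))
      combine (inj₂ x≡y) (inj₂ s)    =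
        inj₂ (subst (λ z → S (g (ws ++ z ∷ xs)) (g (ws ++ y ∷ ys))) (sym (ℕ⁺-≡ x≡y)) s)

-- Counting

𝟙 : ∀ {A : Set} → Dec A → ℕ
𝟙 a? = if does a? then 1 else 0

𝟙-mono : ∀ {A B : Set} (a? : Dec A) (b? : Dec B) → (A → B) → 𝟙 a? ≤ 𝟙 b?
𝟙-mono (yes a) (yes b) f = ≤-refl
𝟙-mono (yes a) (no ¬b) f = contradiction (f a) ¬b
𝟙-mono (no ¬a) b?      f = z≤n

𝟙-true : ∀ {A : Set} (a? : Dec A) → A → 𝟙 a? ≡ 1
𝟙-true a? a = cong (if_then 1 else 0) (dec-true a? a)

𝟙-false : ∀ {A : Set} (a? : Dec A) → ¬ A → 𝟙 a? ≡ 0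
𝟙-false a? ¬a = cong (if_then 1 else 0) (dec-false a? ¬a)

sum-mono-≤ : ∀ {n} {f g : Fin n → ℕ} → (∀ i → f i ≤ g i) → sum f ≤ sum g
sum-mono-≤ {zero}  f≤g = z≤n
sum-mono-≤ {suc n} f≤g = +-mono-≤ (f≤g zero) (sum-mono-≤ (f≤g ∘ suc))

-- Slack at a single index would make the sum of `g` exceed that of `f`. This passes from equal
-- totals to each single ball.
sum-squeeze : ∀ {n} {f g : Fin n → ℕ} → (∀ i → f i ≤ g i) → sum g ≤ sum f → ∀ i → g i ≤ f i
sum-squeeze {f = f} {g} f≤g Σg≤Σf zero =
  +-cancelʳ-≤ (sum (g ∘ suc)) (g zero) (f zero)
    (≤-trans Σg≤Σf (+-monoʳ-≤ (f zero) (sum-mono-≤ (f≤g ∘ suc))))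
sum-squeeze {f = f} {g} f≤g Σg≤Σf (suc i) =
  sum-squeeze (f≤g ∘ suc)
    (+-cancelˡ-≤ (f zero) _ _ (≤-trans (+-monoˡ-≤ _ (f≤g zero)) Σg≤Σf)) i

count : ∀ {n} {P : Pred (Fin n) 0ℓ} → Decidable P → ℕ
count {n} P? = ∑[ v < n ] 𝟙 (P? v)

module _ {n} {P Q : Pred (Fin n) 0ℓ} (P? : Decidable P) (Q? : Decidable Q) where

  count-mono : P ⊆ Q → count P? ≤ count Q?
  count-mono P⊆Q = sum-mono-≤ (λ v → 𝟙-mono (P? v) (Q? v) P⊆Q)

  count-∪ : count (P? ∪? Q?) ≤ count P? + count Q?
  count-∪ = begin
    count (P? ∪? Q?)                    ≤⟨ sum-mono-≤ (λ v → 𝟙-∪ (P? v) (Q? v)) ⟩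
    (∑[ v < n ] (𝟙 (P? v) + 𝟙 (Q? v)))  ≡⟨ ∑-distrib-+ (𝟙 ∘ P?) (𝟙 ∘ Q?) ⟩
    count P? + count Q?                 ∎
    where
    open ≤-Reasoning
    𝟙-∪ : ∀ {A B : Set} (a? : Dec A) (b? : Dec B) → 𝟙 (a? ⊎-dec b?) ≤ 𝟙 a? + 𝟙 b?
    𝟙-∪ (yes _) b? = s≤s z≤n
    𝟙-∪ (no _)  b? = ≤-refl

  count-disjoint : ∀ {R : Pred (Fin n) 0ℓ} (R? : Decidable R) →
                   (∀ v → P v → ¬ Q v) → P ⊆ R → Q ⊆ R → count P? + count Q? ≤ count R?
  count-disjoint R? P∩Q=∅ P⊆R Q⊆R = begin
    count P? + count Q?                 ≡⟨ ∑-distrib-+ (𝟙 ∘ P?) (𝟙 ∘ Q?) ⟨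
    (∑[ v < n ] (𝟙 (P? v) + 𝟙 (Q? v)))  ≤⟨ sum-mono-≤ (λ v → 𝟙-disjoint (P? v) (Q? v) (R? v) (P∩Q=∅ v) P⊆R Q⊆R) ⟩
    count R?                            ∎
    where
    open ≤-Reasoning
    𝟙-disjoint : ∀ {A B D : Set} (a? : Dec A) (b? : Dec B) (d? : Dec D) →
                 (A → ¬ B) → (A → D) → (B → D) → 𝟙 a? + 𝟙 b? ≤ 𝟙 d?
    𝟙-disjoint (yes a) (yes b) d? a# f g = contradiction b (a# a)
    𝟙-disjoint (yes a) (no _)  d? a# f g = 𝟙-mono (yes a) d? f
    𝟙-disjoint (no _)  b?      d? a# f g = 𝟙-mono b? d? g

count-none : ∀ {n} {P : Pred (Fin n) 0ℓ} (P? : Decidable P) → (∀ v → ¬ P v) → count P? ≡ 0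
count-none {n} P? ¬P =
  trans (sum-cong-≗ (λ v → 𝟙-false (P? v) (¬P v))) (sum-replicate-zero n)

count-all : ∀ {n} {P : Pred (Fin n) 0ℓ} (P? : Decidable P) → (∀ v → P v) → count P? ≡ n
count-all {zero}  P? all-P = refl
count-all {suc n} P? all-P = cong₂ _+_ (𝟙-true (P? zero) (all-P zero)) (count-all (P? ∘ suc) (all-P ∘ suc))

count-≤ : ∀ {n} {P : Pred (Fin n) 0ℓ} (P? : Decidable P) → count P? ≤ n
count-≤ {zero}  P? = z≤n
count-≤ {suc n} P? = +-mono-≤ (𝟙-mono (P? zero) (yes tt) _) (count-≤ (P? ∘ suc))

count-≡ : ∀ {n} (x : Fin n) → count (_≟ᶠ x) ≡ 1
count-≡ {suc n} zero    = cong suc (count-none {n} (λ v → suc v ≟ᶠ zero) (λ _ ()))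
count-≡ {suc n} (suc x) = count-≡ x

count-∈ : ∀ {n} (xs : List (Fin n)) → count (λ v → _∈?_ _≟ᶠ_ v xs) ≤ length xs
count-∈ {n} []   = ≤-reflexive (count-none {n} (λ v → _∈?_ _≟ᶠ_ v []) (λ _ ()))
count-∈ (x ∷ xs) = begin
  count (∈? (x ∷ xs))                ≤⟨ count-mono (∈? (x ∷ xs)) ((_≟ᶠ x) ∪? ∈? xs)
                                          (λ { (here v≡x) → inj₁ v≡x ; (there v∈xs) → inj₂ v∈xs }) ⟩
  count ((_≟ᶠ x) ∪? ∈? xs)           ≤⟨ count-∪ (_≟ᶠ x) (∈? xs) ⟩
  count (_≟ᶠ x) + count (∈? xs)      ≤⟨ +-mono-≤ (≤-reflexive (count-≡ x)) (count-∈ xs) ⟩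
  suc (length xs)                    ∎
  where
  open ≤-Reasoning
  ∈? : ∀ ys → Decidable (_∈ ys)
  ∈? ys v = _∈?_ _≟ᶠ_ v ys

count-third : ∀ {n} {P : Pred (Fin n) 0ℓ} (P? : Decidable P) {u v w} →
              P u → P v → P w → u ≢ v → u ≢ w → v ≢ w → 3 ≤ count P?
count-third P? {u} {v} {w} pu pv pw u≢v u≢w v≢w = begin
  3                                                  ≡⟨ cong₂ _+_ (cong₂ _+_ (count-≡ u) (count-≡ v)) (count-≡ w) ⟨
  count (_≟ᶠ u) + count (_≟ᶠ v) + count (_≟ᶠ w)      ≤⟨ +-monoˡ-≤ _ (count-disjoint (_≟ᶠ u) (_≟ᶠ v) ((_≟ᶠ u) ∪? (_≟ᶠ v))
                                                          (λ { _ refl u≡v → u≢v u≡v }) inj₁ inj₂) ⟩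
  count ((_≟ᶠ u) ∪? (_≟ᶠ v)) + count (_≟ᶠ w)         ≤⟨ count-disjoint ((_≟ᶠ u) ∪? (_≟ᶠ v)) (_≟ᶠ w) P?
                                                          (λ { _ (inj₁ refl) u≡w → u≢w u≡w ; _ (inj₂ refl) v≡w → v≢w v≡w })
                                                          (λ { (inj₁ refl) → pu ; (inj₂ refl) → pv }) (λ { refl → pw }) ⟩
  count P?                                           ∎
  where open ≤-Reasoning

count-other : ∀ {n} {P : Pred (Fin n) 0ℓ} (P? : Decidable P) → 2 ≤ count P? → ∀ u → ∃[ v ] P v × v ≢ u
count-other P? 2≤ u with any? (λ v → P? v ×-dec ¬? (v ≟ᶠ u))
... | yes found = found
... | no ¬found = contradiction 2≤ (<⇒≱ (s≤s (≤-trans (count-mono P? (_≟ᶠ u) only) (≤-reflexive (count-≡ u)))))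
  where
  only : ∀ {v} → _ → v ≡ u
  only {v} pv = decidable-stable (v ≟ᶠ u) λ v≢u → ¬found (v , pv , v≢u)

-- `κ-Connected` removes a `Subset`, while distance layers are decidable predicates; this links the
-- two notions of size.
∣tabulate∣ : ∀ {n} {P : Pred (Fin n) 0ℓ} (P? : Decidable P) →
             ∣ tabulateᵛ (does ∘ P?) ∣ ≡ count P?
∣tabulate∣ {zero}  P? = refl
∣tabulate∣ {suc n} P? with P? zero
... | yes _ = cong suc (∣tabulate∣ (P? ∘ suc))
... | no _  = ∣tabulate∣ (P? ∘ suc)

-- Sorted lists of positive integers

countᴸ : ℕ → List ℕ⁺ → ℕ
countᴸ i xs = ListAction.sum (map (λ x → 𝟙 (proj₁ x ≤? i)) xs)

countᴸ-none : ∀ {i xs} → All (λ x → i < proj₁ x) xs → countᴸ i xs ≡ 0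
countᴸ-none                    []           = refl
countᴸ-none {i} {x ∷ _} (i<x ∷ i<xs) =
  cong₂ _+_ (𝟙-false (proj₁ x ≤? i) (<⇒≱ i<x)) (countᴸ-none i<xs)

-- An entry of a sorted list is at most `i` exactly when enough entries are counted up to `i`, so
-- larger counts mean smaller entries.
sorted-pointwise : ∀ {xs ys} → AllPairs _≤⁺_ xs → AllPairs _≤⁺_ ys → length xs ≡ length ys →
                   (∀ i → countᴸ i ys ≤ countᴸ i xs) → Pointwise _≤⁺_ xs ys
sorted-pointwise {[]}     {[]}     _ _ _  _  = []
sorted-pointwise {x ∷ xs} {y ∷ ys} (x≤xs ∷ xs↗) (y≤ys ∷ ys↗) eq ys≤xs =
  x≤y ∷ sorted-pointwise xs↗ ys↗ (suc-injective eq) tails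
  where
  open ≤-Reasoning

  x≤y : x ≤⁺ y
  -- If `y` were smaller, threshold `y` would count `y` itself but nothing in `x ∷ xs`.
  x≤y = ≮⇒≥ λ y<x → n≮0 (begin-strict
    0                        <⟨ m≤m+n 1 (countᴸ (proj₁ y) ys) ⟩
    1 + countᴸ (proj₁ y) ys  ≡⟨ cong (_+ countᴸ (proj₁ y) ys) (𝟙-true (proj₁ y ≤? proj₁ y) ≤-refl) ⟨
    countᴸ (proj₁ y) (y ∷ ys) ≤⟨ ys≤xs (proj₁ y) ⟩
    countᴸ (proj₁ y) (x ∷ xs) ≡⟨ countᴸ-none {xs = x ∷ xs} (y<x ∷ All.map (<-≤-trans y<x) x≤xs) ⟩
    0                        ∎)

  tails : ∀ i → countᴸ i ys ≤ countᴸ i xs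
  -- From threshold `y` on both heads count and cancel; below it nothing in `ys` counts.
  tails i with proj₁ y ≤? i
  ... | yes y≤i = +-cancelˡ-≤ 1 _ _ (subst₂ (λ a b → a + countᴸ i ys ≤ b + countᴸ i xs)
                    (𝟙-true (proj₁ y ≤? i) y≤i)
                    (𝟙-true (proj₁ x ≤? i) (≤-trans x≤y y≤i)) (ys≤xs i))
  ... | no y≰i  = ≤-trans (≤-reflexive (countᴸ-none (All.map (<-≤-trans (≰⇒> y≰i)) y≤ys))) z≤n

-- Sums over unordered pairs

sum-concatMap : ∀ {A B : Set} (h : B → ℕ) (g : A → List B) {n} (f : Fin n → A) →
                ListAction.sum (map h (concatMap g (tabulate f))) ≡
                ∑[ i < n ] ListAction.sum (map h (g (f i)))
sum-concatMap h g {zero}  f = refl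
sum-concatMap h g {suc n} f = begin
  ListAction.sum (map h (head ++ tail))                      ≡⟨ cong ListAction.sum (map-++ h head tail) ⟩
  ListAction.sum (map h head ++ map h tail)                  ≡⟨ sum-++ (map h head) (map h tail) ⟩
  ListAction.sum (map h head) + ListAction.sum (map h tail)
    ≡⟨ cong (ListAction.sum (map h head) +_) (sum-concatMap h g (f ∘ suc)) ⟩
  (∑[ i < suc n ] ListAction.sum (map h (g (f i))))          ∎
  where
  open ≡-Reasoning
  head = g (f zero)
  tail = concatMap g (tabulate (f ∘ suc))

sum-mapMaybe : ∀ {A B : Set} (h : B → ℕ) (p : A → Maybe B) {n} (f : Fin n → A) →
               ListAction.sum (map h (mapMaybe p (tabulate f))) ≡
               ∑[ i < n ] maybe h 0 (p (f i))
sum-mapMaybe h p {zero}  f = refl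
sum-mapMaybe h p {suc n} f with p (f zero)
... | just b  = cong (h b +_) (sum-mapMaybe h p (f ∘ suc))
... | nothing = sum-mapMaybe h p (f ∘ suc)

∑∑< : ∀ n → (Fin n → Fin n → ℕ) → ℕ
∑∑< n W = ∑[ u < n ] ∑[ v < n ] (𝟙 (u <ᶠ? v) * W u v)

sum-unorderedPairs : ∀ {n} {A : Set} (w : A → ℕ) (W : Fin n → Fin n → ℕ)
                     (f : (∃₂ λ (u v : Fin n) → u <ᶠ v) → A) →
                     (∀ u v (u<v : u <ᶠ v) → w (f (u , v , u<v)) ≡ W u v) →
                     ListAction.sum (map w (map f (unorderedPairs n))) ≡ ∑∑< n W
sum-unorderedPairs {n} w W f eq = trans (cong ListAction.sum (sym (map-∘ (unorderedPairs n))))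
  (trans (sum-concatMap (w ∘ f) _ {n} id)
  (sum-cong-≗ λ u → trans (sum-mapMaybe (w ∘ f) _ {n} id) (sum-cong-≗ (weight u))))
  where
  weight : ∀ u v → maybe (w ∘ f) 0 (mapᵐ (λ u<v → u , v , u<v) (dec⇒maybe (u <ᶠ? v))) ≡
                   𝟙 (u <ᶠ? v) * W u v
  weight u v with u <ᶠ? v
  ... | yes u<v = trans (eq u v u<v) (trans (sym (*-identityˡ (W u v)))
                    (cong (_* W u v) (sym (𝟙-true (u <ᶠ? v) u<v))))
  ... | no u≮v  = cong (_* W u v) (sym (𝟙-false (u <ᶠ? v) u≮v))

-- Ordered pairs split into the diagonal and two triangles, and `∑-comm` folds one triangle onto the
-- other.
∑∑-symmetric : ∀ {n} (W : Fin n → Fin n → ℕ) → (∀ u v → W u v ≡ W v u) →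
               ∑[ u < n ] ∑[ v < n ] W u v ≡ (∑[ u < n ] W u u) + (∑∑< n W + ∑∑< n W)
∑∑-symmetric {n} W W-sym = begin
  (∑[ u < n ] ∑[ v < n ] W u v)
    ≡⟨ sum-cong-≗ (λ u → sum-cong-≗ (split u)) ⟩
  (∑[ u < n ] ∑[ v < n ] (D u v + (L u v + L v u)))
    ≡⟨ sum-cong-≗ (λ u → trans (∑-distrib-+ (D u) _)
         (cong (sum (D u) +_) (∑-distrib-+ (L u) (flip L u)))) ⟩
  (∑[ u < n ] (sum (D u) + (sum (L u) + sum (flip L u))))
    ≡⟨ trans (∑-distrib-+ (sum ∘ D) _)
         (cong (sum (sum ∘ D) +_) (∑-distrib-+ (sum ∘ L) (sum ∘ flip L))) ⟩
  (∑[ u < n ] sum (D u)) + (∑∑< n W + (∑[ u < n ] ∑[ v < n ] L v u))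
    ≡⟨ cong₂ (λ a b → a + (∑∑< n W + b)) (sum-cong-≗ diagonal) (∑-comm (flip L)) ⟩
  (∑[ u < n ] W u u) + (∑∑< n W + ∑∑< n W) ∎
  where
  open ≡-Reasoning
  D L : Fin n → Fin n → ℕ
  -- The weight `W u u` in place of `W u v` is constant in `v` and so factors out of the sum.
  D u v = 𝟙 (v ≟ᶠ u) * W u u
  L u v = 𝟙 (u <ᶠ? v) * W u v

  diagonal : ∀ u → sum (D u) ≡ W u u
  diagonal u = trans (sym (*-distribʳ-sum (W u u) (λ v → 𝟙 (v ≟ᶠ u))))
    (trans (cong (_* W u u) (count-≡ u)) (*-identityˡ _))

  split : ∀ u v → W u v ≡ D u v + (L u v + L v u)
  split u v with <ᶠ-cmp u v
  ... | tri< u<v u≢v v≮u = begin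
    W u v                ≡⟨ *-identityˡ _ ⟨
    1 * W u v            ≡⟨ +-identityʳ _ ⟨
    1 * W u v + 0        ≡⟨ cong₂ _+_ (cong (_* W u v) (𝟙-true (u <ᶠ? v) u<v))
                                      (cong (_* W v u) (𝟙-false (v <ᶠ? u) v≮u)) ⟨
    L u v + L v u        ≡⟨ cong (λ a → a * W u u + (L u v + L v u)) (𝟙-false (v ≟ᶠ u) (u≢v ∘ sym)) ⟨
    D u v + (L u v + L v u) ∎
  ... | tri> u≮v u≢v v<u = begin
    W u v                ≡⟨ W-sym u v ⟩
    W v u                ≡⟨ *-identityˡ _ ⟨
    1 * W v u            ≡⟨ cong₂ _+_ (cong (_* W u v) (𝟙-false (u <ᶠ? v) u≮v))
                                      (cong (_* W v u) (𝟙-true (v <ᶠ? u) v<u)) ⟨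
    L u v + L v u        ≡⟨ cong (λ a → a * W u u + (L u v + L v u)) (𝟙-false (v ≟ᶠ u) (u≢v ∘ sym)) ⟨
    D u v + (L u v + L v u) ∎
  ... | tri≈ u≮v refl v≮u = begin
    W u u                ≡⟨ *-identityˡ _ ⟨
    1 * W u u            ≡⟨ +-identityʳ _ ⟨
    1 * W u u + 0        ≡⟨ cong₂ _+_ (cong (_* W u u) (𝟙-true (u ≟ᶠ u) refl))
                              (cong (λ a → a * W u u + a * W u u) (𝟙-false (u <ᶠ? u) u≮v)) ⟨
    D u u + (L u u + L u u) ∎

-- Walks and distances

snoc : ∀ {V} {G : Graph V} {u v w k} → Walk G u v k → Adj G v w → Walk G u w (suc k)
snoc []      a = a ∷ []
snoc (b ∷ p) a = b ∷ snoc p a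

reverse : ∀ {V} {G : Graph V} {u v k} → Walk G u v k → Walk G v u k
reverse []              = []
reverse {G = G} (a ∷ p) = snoc (reverse p) (adj-sym G a)

append : ∀ {V} {G : Graph V} {u v w j k} → Walk G u v j → Walk G v w k → Walk G u w (j + k)
append []      q = q
append (a ∷ p) q = a ∷ append p q

mapWalk : ∀ {V W} {G : Graph V} {H : Graph W} (f : V → W) →
          (∀ {u v} → Adj G u v → Adj H (f u) (f v)) →
          ∀ {u v k} → Walk G u v k → Walk H (f u) (f v) k
mapWalk f f-adj []      = []
mapWalk f f-adj (a ∷ p) = f-adj a ∷ mapWalk f f-adj p

-- Induction along the walk. It serves twice: no walk escapes from inside a removed layer, and a
-- cycle closed under adjacency fills a connected graph.
closed⇒reachable : ∀ {V} {G : Graph V} {P : V → Set} → (∀ {u v} → Adj G u v → P u → P v) →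
                   ∀ {u v k} → Walk G u v k → P u → P v
closed⇒reachable closed []      pu = pu
closed⇒reachable closed (a ∷ p) pu = closed⇒reachable closed p (closed a pu)

module _ {n} (G : Graph (Fin n)) (c : Connected G) where

  geodesic : ∀ u v → Walk G u v (dist G c u v)
  geodesic u v = proj₁ (proj₂ (distance G (c u v)))

  dist-min : ∀ {u v k} → Walk G u v k → dist G c u v ≤ k
  dist-min {u} {v} p = proj₂ (proj₂ (distance G (c u v))) _ p

  dist-sym : ∀ u v → dist G c u v ≡ dist G c v u
  dist-sym u v = ≤-antisym (dist-min (reverse (geodesic v u))) (dist-min (reverse (geodesic u v)))

  dist-refl : ∀ u → dist G c u u ≡ 0
  dist-refl u = n≤0⇒n≡0 (dist-min [])

  dist-step : ∀ u {v w} → Adj G v w → dist G c u w ≤ suc (dist G c u v)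
  dist-step u a = dist-min (snoc (geodesic u _) a)

  ball : Fin n → ℕ → ℕ
  ball u i = count (λ v → dist G c u v ≤? i)

  -- A layer other than the outermost one is a cut.
  layer-≥ : ∀ {κ} → κ-Connected κ G → ∀ u i → 0 < i → (∃[ v ] i < dist G c u v) →
            κ ≤ count (λ v → dist G c u v ≟ i)
  layer-≥ {κ} (_ , conn) u i 0<i (v , i<d) = ≮⇒≥ λ small →
    -- Removing a layer smaller than `κ` would leave a walk from `u`, inside the layer, to `v`,
    -- outside it.
    let _ , p = conn S (subst (_< κ) (sym (∣tabulate∣ layer?)) small) (u , ∉S (<⇒≢ du<i)) (v , ∉S (>⇒≢ i<d))
    in <⇒≯ i<d (closed⇒reachable {P = λ x → dist G c u (proj₁ x) < i} (λ {x} {y} → inside {x} {y}) p du<i)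
    where
    layer? : Decidable (λ x → dist G c u x ≡ i)
    layer? x = dist G c u x ≟ i

    S : Subset n
    S = tabulateᵛ (does ∘ layer?)

    ∉S : ∀ {x} → dist G c u x ≢ i → x ∉ S
    ∉S {x} d≢i x∈S = contradiction
      (trans (sym ([]=⇒lookup x∈S)) (trans (lookup∘tabulate (does ∘ layer?) x) (dec-false (layer? x) d≢i)))
      λ ()

    ∉S⁻ : ∀ {x} → x ∉ S → dist G c u x ≢ i
    ∉S⁻ {x} x∉S d≡i = x∉S (lookup⇒[]= x S
      (trans (lookup∘tabulate (does ∘ layer?) x) (dec-true (layer? x) d≡i)))

    du<i : dist G c u u < i
    du<i = subst (_< i) (sym (dist-refl u)) 0<i

    inside : ∀ {x y} → Adj (G -ᵍ S) x y → dist G c u (proj₁ x) < i → dist G c u (proj₁ y) < i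
    -- The distance from `u` grows by at most one along an edge, and the value `i` is excluded.
    inside {_} {y , y∉S} a dx<i = ≤∧≢⇒< (≤-trans (dist-step u a) dx<i) (∉S⁻ y∉S)

  ball-≥ : ∀ {κ} → κ-Connected κ G → ∀ u i → n ⊓ (1 + κ * i) ≤ ball u i
  ball-≥ {κ} κ-conn u zero = begin
    n ⊓ (1 + κ * 0)  ≤⟨ m⊓n≤n n _ ⟩
    1 + κ * 0        ≡⟨ cong suc (*-zeroʳ κ) ⟩
    1                ≡⟨ count-≡ u ⟨
    count (_≟ᶠ u)    ≤⟨ count-mono (_≟ᶠ u) (λ v → dist G c u v ≤? 0) (λ { refl → dist-min [] }) ⟩
    ball u 0         ∎
    where open ≤-Reasoning
  ball-≥ {κ} κ-conn u (suc i) with all? (λ v → dist G c u v ≤? suc i)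
  ... | yes near = ≤-trans (m⊓n≤m n _)
                     (≤-reflexive (sym (count-all (λ v → dist G c u v ≤? suc i) near)))
  ... | no ¬near =
    -- Some `v` lies beyond radius `suc i`, so the layer at that radius is not the outermost.
    let v , d≰ = ¬∀⟶∃¬ n _ (λ v → dist G c u v ≤? suc i) ¬near
    in begin
    n ⊓ (1 + κ * suc i)        ≡⟨ cong (λ a → n ⊓ suc a) (trans (*-suc κ i) (+-comm κ _)) ⟩
    -- Enlarging `n` to `n + κ` lets `κ` be taken out of the minimum; the layer at distance `suc i`
    -- then supplies it.
    n ⊓ (1 + κ * i + κ)        ≤⟨ ⊓-monoˡ-≤ _ (m≤m+n n κ) ⟩
    (n + κ) ⊓ (1 + κ * i + κ)  ≡⟨ +-distribʳ-⊓ κ n (1 + κ * i) ⟨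
    n ⊓ (1 + κ * i) + κ        ≤⟨ +-mono-≤ (ball-≥ κ-conn u i) (layer-≥ κ-conn u (suc i) z<s (v , ≰⇒> d≰)) ⟩
    ball u i + count (λ v → dist G c u v ≟ suc i)
      ≤⟨ count-disjoint (λ v → dist G c u v ≤? i) (λ v → dist G c u v ≟ suc i) (λ v → dist G c u v ≤? suc i)
           (λ v d≤i d≡1+i → 1+n≰n (subst (_≤ i) d≡1+i d≤i)) m≤n⇒m≤1+n ≤-reflexive ⟩
    ball u (suc i)             ∎
    where open ≤-Reasoning

  total : ℕ → ℕ
  total i = ∑[ u < n ] ball u i

  private
    near : ℕ → Fin n → Fin n → ℕ
    near i u v = 𝟙 (dist G c u v ≤? i)

  -- `total i` counts ordered pairs at distance at most `i`: each vertex with itself once, each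
  -- unordered pair twice. Sorting only permutes the distances.
  total-countᴸ : ∀ i → total i ≡ (∑[ u < n ] 1) + (countᴸ i (𝒟 ⟨ G , c ⟩) + countᴸ i (𝒟 ⟨ G , c ⟩))
  total-countᴸ i = trans
    (∑∑-symmetric (near i) λ u v → cong (λ d → 𝟙 (d ≤? i)) (dist-sym u v))
    (cong₂ (λ a b → a + (b + b))
      (sum-cong-≗ (λ u → 𝟙-true (dist G c u u ≤? i) (≤-trans (dist-min {k = 0} []) z≤n)))
      (sym (trans (sum-↭ (map⁺ _ (Sort.sort-↭ ℕ⁺-decTotalOrder _)))
                  (sum-unorderedPairs {n} (λ x → 𝟙 (proj₁ x ≤? i)) (near i) _ λ _ _ _ → refl))))

  𝒟-length : length (𝒟 ⟨ G , c ⟩) ≡ length (unorderedPairs n)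
  𝒟-length = trans (↭-length (Sort.sort-↭ ℕ⁺-decTotalOrder _)) (length-map _ (unorderedPairs n))

  𝒟-sorted : AllPairs _≤⁺_ (𝒟 ⟨ G , c ⟩)
  𝒟-sorted = Linked⇒AllPairs ≤-trans (Sort.sort-↗ ℕ⁺-decTotalOrder _)

module _ {n} {G H : Graph (Fin n)} (cG : Connected G) (cH : Connected H) where

  -- The diagonal depends on `n` alone and cancels; halving the rest leaves the counts that
  -- `sorted-pointwise` compares.
  𝒟-pointwise : (∀ i → total H cH i ≤ total G cG i) → Pointwise _≤⁺_ (𝒟 ⟨ G , cG ⟩) (𝒟 ⟨ H , cH ⟩)
  𝒟-pointwise H≤G = sorted-pointwise (𝒟-sorted G cG) (𝒟-sorted H cH)
    (trans (𝒟-length G cG) (sym (𝒟-length H cH)))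
    λ i → halve (+-cancelˡ-≤ (∑[ u < n ] 1) _ _
      (subst₂ _≤_ (total-countᴸ H cH i) (total-countᴸ G cG i) (H≤G i)))
    where
    halve : ∀ {a b} → a + a ≤ b + b → a ≤ b
    halve a+a≤b+b = ≮⇒≥ λ b<a → <⇒≱ (+-mono-< b<a b<a) a+a≤b+b

  𝒟-≡⇒total-≡ : 𝒟 ⟨ G , cG ⟩ ≡ 𝒟 ⟨ H , cH ⟩ → ∀ i → total G cG i ≡ total H cH i
  𝒟-≡⇒total-≡ eq i = trans (total-countᴸ G cG i)
    (trans (cong (λ xs → (∑[ u < n ] 1) + (countᴸ i xs + countᴸ i xs)) eq) (sym (total-countᴸ H cH i)))

-- Balls in powers of cycles

next-functional : ∀ {n} {i j k : Fin n} → Next i j → Next i k → j ≡ k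
next-functional (inj₁ j=1+i) (inj₁ k=1+i) = toℕ-injective (trans j=1+i (sym k=1+i))
next-functional {j = j} (inj₁ j=1+i) (inj₂ (1+i=n , _)) =
  contradiction (trans j=1+i 1+i=n) (<⇒≢ (toℕ<n j))
next-functional {k = k} (inj₂ (1+i=n , _)) (inj₁ k=1+i) =
  contradiction (trans k=1+i 1+i=n) (<⇒≢ (toℕ<n k))
next-functional (inj₂ (_ , j=0)) (inj₂ (_ , k=0)) = toℕ-injective (trans j=0 (sym k=0))

next-injective : ∀ {n} {i j k : Fin n} → Next i k → Next j k → i ≡ j
next-injective (inj₁ k=1+i) (inj₁ k=1+j) =
  toℕ-injective (suc-injective (trans (sym k=1+i) k=1+j))
next-injective (inj₁ k=1+i) (inj₂ (_ , k=0)) = contradiction (trans (sym k=0) k=1+i) λ ()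
next-injective (inj₂ (_ , k=0)) (inj₁ k=1+j) = contradiction (trans (sym k=0) k=1+j) λ ()
next-injective (inj₂ (1+i=n , _)) (inj₂ (1+j=n , _)) =
  toℕ-injective (suc-injective (trans 1+i=n (sym 1+j=n)))

successor : ∀ {n} (i : Fin n) → ∃ (Next i)
successor {suc n} i with suc (toℕ i) <? suc n
... | yes 1+i<n = fromℕ< 1+i<n , inj₁ (toℕ-fromℕ< 1+i<n)
... | no  1+i≮n = zero , inj₂ (≤-antisym (toℕ<n i) (≮⇒≥ 1+i≮n) , refl)

predecessor : ∀ {n} (j : Fin n) → ∃ λ i → Next i j
predecessor {suc n} zero    = fromℕ n , inj₂ (cong suc (toℕ-fromℕ n) , refl)
predecessor         (suc j) = inject₁ j , inj₁ (cong suc (sym (toℕ-inject₁ j)))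

next prev : ∀ {n} → Fin n → Fin n
next i = proj₁ (successor i)
prev j = proj₁ (predecessor j)

next-prev : ∀ {n} (i : Fin n) → next (prev i) ≡ i
next-prev i = next-functional (proj₂ (successor (prev i))) (proj₂ (predecessor i))

prev-next : ∀ {n} (i : Fin n) → prev (next i) ≡ i
prev-next i = next-injective (proj₂ (predecessor (next i))) (proj₂ (successor i))

-- Steps in opposite directions cancel, so the net displacement has one direction and at most the
-- length of the walk.
C-walk-end : ∀ {n} {u v : Fin n} {k} → Walk (C n) u v k →
             ∃[ j ] j ≤ k × (v ≡ iterate next u j ⊎ v ≡ iterate prev u j)
C-walk-end [] = 0 , z≤n , inj₁ refl
C-walk-end ((_ , inj₁ u→w) ∷ p)
  with refl ← next-functional u→w (proj₂ (successor _)) | C-walk-end p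
... | j     , j≤k , inj₁ v≡ = suc j , s≤s j≤k , inj₁ v≡
... | zero  , j≤k , inj₂ v≡ = 1 , s≤s z≤n , inj₁ v≡
-- The first backward step undoes the forward step just taken.
... | suc j , j≤k , inj₂ v≡ =
  j , ≤-trans (n≤1+n j) (m≤n⇒m≤1+n j≤k) , inj₂ (trans v≡ (cong (λ x → iterate prev x j) (prev-next _)))
C-walk-end ((_ , inj₂ w→u) ∷ p)
  with refl ← next-injective w→u (proj₂ (predecessor _)) | C-walk-end p
... | j     , j≤k , inj₂ v≡ = suc j , s≤s j≤k , inj₂ v≡
... | zero  , j≤k , inj₁ v≡ = 1 , s≤s z≤n , inj₂ v≡
... | suc j , j≤k , inj₁ v≡ =
  j , ≤-trans (n≤1+n j) (m≤n⇒m≤1+n j≤k) , inj₁ (trans v≡ (cong (λ x → iterate next x j) (next-prev _)))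

-- Vertices may repeat when the arc wraps round the cycle; this is harmless, as its length only
-- serves as an upper bound.
arc : ∀ {n} → Fin n → ℕ → List (Fin n)
arc u zero    = [ u ]
arc u (suc m) = iterate next u (suc m) ∷ iterate prev u (suc m) ∷ arc u m

length-arc : ∀ {n} (u : Fin n) m → length (arc u m) ≡ 1 + 2 * m
length-arc u zero    = refl
length-arc u (suc m) = cong suc (trans (cong suc (length-arc u m)) (sym (*-suc 2 m)))

∈-arc : ∀ {n} {u v : Fin n} m {j} → j ≤ m → v ≡ iterate next u j ⊎ v ≡ iterate prev u j → v ∈ arc u m
∈-arc zero    z≤n v≡ = here ([ id , id ]′ v≡)
∈-arc (suc m) {j} j≤1+m v≡ with m≤n⇒m<n∨m≡n j≤1+m
... | inj₁ (s≤s j≤m) = there (there (∈-arc m j≤m v≡))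
... | inj₂ refl      = [ here , there ∘ here ]′ v≡

-- Each edge of the power expands to a shortest walk of at most `k` edges.
power-walk : ∀ {n k} {G : Graph (Fin n)} {u v j} → Walk (G ^ᵍ k) u v j → ∃[ i ] i ≤ k * j × Walk G u v i
power-walk [] = 0 , z≤n , []
power-walk {k = k} {j = suc j} ((_ , d , (q , _) , d≤k) ∷ p) =
  let i , i≤kj , p′ = power-walk p
  in  d + i , ≤-trans (+-mono-≤ d≤k i≤kj) (≤-reflexive (sym (*-suc k j))) , append q p′

adj⇒adj-^ : ∀ {n k} (G : Graph (Fin n)) → 0 < k → ∀ {u v} → Adj G u v → Adj (G ^ᵍ k) u v
adj⇒adj-^ G 0<k {u} {v} a = u≢v , 1 , (a ∷ [] , 1≤) , 0<k
  where
  u≢v : u ≢ v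
  u≢v refl = adj-irrefl G a
  1≤ : ∀ j → Walk G u v j → 1 ≤ j
  1≤ zero    [] = contradiction refl u≢v
  1≤ (suc j) _  = s≤s z≤n

-- Expanded into the cycle, walks of length at most `i` in the power end on the arc reaching `k * i`
-- steps either way. The factor `k * 2` is the `κ` of `ball-≥`.
ball-C^-≤ : ∀ {n k} (c : Connected (C n ^ᵍ k)) u i → ball (C n ^ᵍ k) c u i ≤ n ⊓ (1 + k * 2 * i)
ball-C^-≤ {n} {k} c u i = ⊓-glb (count-≤ near?) (begin
  count near?                                       ≤⟨ count-mono near? ∈arc? in-arc ⟩
  count ∈arc?                                       ≤⟨ count-∈ (arc u (k * i)) ⟩
  length (arc u (k * i))                            ≡⟨ length-arc u (k * i) ⟩
  1 + 2 * (k * i)                                   ≡⟨ cong suc (*-assoc 2 k i) ⟨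
  1 + 2 * k * i                                     ≡⟨ cong (λ a → suc (a * i)) (*-comm 2 k) ⟩
  1 + k * 2 * i                                     ∎)
  where
  open ≤-Reasoning
  near? : Decidable (λ v → dist (C n ^ᵍ k) c u v ≤ i)
  near? v = dist (C n ^ᵍ k) c u v ≤? i

  ∈arc? : Decidable (_∈ arc u (k * i))
  ∈arc? v = _∈?_ _≟ᶠ_ v (arc u (k * i))

  in-arc : ∀ {v} → dist (C n ^ᵍ k) c u v ≤ i → v ∈ arc u (k * i)
  in-arc {v} d≤i =
    let l , l≤kd , p = power-walk (geodesic (C n ^ᵍ k) c u v)
        j , j≤l , v≡ = C-walk-end p
    in  ∈-arc (k * i) (≤-trans j≤l (≤-trans l≤kd (*-monoʳ-≤ k d≤i))) v≡

-- The two ball estimates meet at `n ⊓ (1 + k * 2 * i)` for every centre and radius.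
κ-connected-𝒟-≤ : ∀ {n} {G : Graph (Fin n)} k (cG : Connected G) (cC : Connected (C n ^ᵍ k)) →
                  κ-Connected (k * 2) G → Pointwise _≤⁺_ (𝒟 ⟨ G , cG ⟩) (𝒟 ⟨ C n ^ᵍ k , cC ⟩)
κ-connected-𝒟-≤ k cG cC κ-conn = 𝒟-pointwise cG cC λ i →
  sum-mono-≤ λ u → ≤-trans (ball-C^-≤ {k = k} cC u i) (ball-≥ _ cG κ-conn u i)

-- The isomorphism carries walks to walks of the same length, so distances do not grow. This is the
-- half of the domination needed to make the sequence of a cycle equal to the extremal one.
cycle-𝒟-≥ : ∀ {n} {G : Graph (Fin n)} (cG : Connected G) (cC : Connected (C n ^ᵍ 1)) →
            G ≅ C n → Pointwise _≤⁺_ (𝒟 ⟨ C n ^ᵍ 1 , cC ⟩) (𝒟 ⟨ G , cG ⟩)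
cycle-𝒟-≥ {n} {G} cG cC (f , f-adj) = 𝒟-pointwise cC cG λ i → begin
  total G cG i                                ≤⟨ sum-mono-≤ (λ u → sum-mono-≤ (λ v →
                                                   𝟙-mono (dist G cG u v ≤? i) (D (to u) (to v) ≤? i) (≤-trans (shorter u v)))) ⟩
  -- Reindexing along the bijection, first the points, then the centres.
  (∑[ u < n ] ∑[ v < n ] 𝟙 (D (to u) (to v) ≤? i)) ≡⟨ sum-cong-≗ (λ u → sum-permute (λ v → 𝟙 (D (to u) v ≤? i)) f) ⟨
  (∑[ u < n ] ball (C n ^ᵍ 1) cC (to u) i)    ≡⟨ sum-permute (λ u → ball (C n ^ᵍ 1) cC u i) f ⟨
  total (C n ^ᵍ 1) cC i                       ∎
  where
  open ≤-Reasoning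
  open Inverse f using (to)
  D : Fin n → Fin n → ℕ
  D = dist (C n ^ᵍ 1) cC
  shorter : ∀ u v → D (to u) (to v) ≤ dist G cG u v
  shorter u v = dist-min (C n ^ᵍ 1) cC
    (mapWalk to (λ {x} {y} → adj⇒adj-^ (C n) z<s ∘ Equivalence.to (f-adj x y)) (geodesic G cG u v))

-- Two-regular connected graphs

degree-ball : ∀ {n} (G : Graph (Fin n)) (c : Connected G) u → suc (count (adj? G u)) ≡ ball G c u 1
degree-ball G c u = ≤-antisym
  (begin
    suc (count (adj? G u))               ≡⟨ cong (_+ count (adj? G u)) (count-≡ u) ⟨
    count (_≟ᶠ u) + count (adj? G u)     ≤⟨ count-disjoint (_≟ᶠ u) (adj? G u) (λ v → dist G c u v ≤? 1)
                                              (λ { _ refl → adj-irrefl G })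
                                              (λ { refl → ≤-trans (dist-min G c []) z≤n })
                                              (λ a → dist-min G c (a ∷ [])) ⟩
    ball G c u 1                         ∎)
  (begin
    ball G c u 1                         ≤⟨ count-mono (λ v → dist G c u v ≤? 1) ((_≟ᶠ u) ∪? adj? G u)
                                              (λ d≤1 → short (geodesic G c u _) d≤1) ⟩
    count ((_≟ᶠ u) ∪? adj? G u)          ≤⟨ count-∪ (_≟ᶠ u) (adj? G u) ⟩
    count (_≟ᶠ u) + count (adj? G u)     ≡⟨ cong (_+ count (adj? G u)) (count-≡ u) ⟩
    suc (count (adj? G u))               ∎)
  where
  open ≤-Reasoning
  short : ∀ {u v k} → Walk G u v k → k ≤ 1 → v ≡ u ⊎ Adj G u v
  short []           _ = inj₁ refl
  short (a ∷ [])     _ = inj₂ a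
  short (_ ∷ _ ∷ _) (s≤s ())

-- The walk s starts with an edge and never turns back. The first vertex it repeats
-- is s 0, since every other s i already has both its neighbours on the walk. Hence
-- the walk closes up to a cycle, which by connectedness contains all the vertices.
module TwoRegular {n} {G : Graph (Fin n)} (c : Connected G) (v₀ : Fin n)
                  (degree-2 : ∀ u → count (adj? G u) ≡ 2) where

  -- The state of the walk is a directed edge, since not turning back depends on the previous
  -- vertex.
  Dart : Set
  Dart = ∃₂ (Adj G)

  abstract
    other : ∀ u v → ∃[ w ] Adj G v w × w ≢ u
    other u v = count-other (adj? G v) (≤-reflexive (sym (degree-2 v))) u

  step : Dart → Dart
  step (u , v , _) = v , proj₁ (other u v) , proj₁ (proj₂ (other u v))

  dart : ℕ → Dart
  -- There is no previous vertex yet; avoiding `v₀` itself leaves any neighbour of `v₀` as the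
  -- choice.
  dart zero    = v₀ , proj₁ (other v₀ v₀) , proj₁ (proj₂ (other v₀ v₀))
  dart (suc i) = step (dart i)

  s : ℕ → Fin n
  s i = proj₁ (dart i)

  s-adj : ∀ i → Adj G (s i) (s (suc i))
  s-adj i = proj₂ (proj₂ (dart i))

  s-turn : ∀ i → s (2 + i) ≢ s i
  s-turn i = proj₂ (proj₂ (other (s i) (s (suc i))))

  -- The preceding and following vertices of the walk are distinct by `s-turn`, so they exhaust the
  -- degree.
  s-neighbours : ∀ i {x} → Adj G (s (suc i)) x → x ≡ s i ⊎ x ≡ s (2 + i)
  s-neighbours i {x} a with x ≟ᶠ s i | x ≟ᶠ s (2 + i)
  ... | yes eq | _      = inj₁ eq
  ... | no _   | yes eq = inj₂ eq
  ... | no x≢  | no x≢′ = contradiction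
    (count-third (adj? G (s (suc i))) a (adj-sym G (s-adj i)) (s-adj (suc i)) x≢ x≢′ (≢-sym (s-turn i)))
    (<⇒≱ (≤-reflexive (cong suc (degree-2 _))))

  Repeats : ℕ → Set
  Repeats j = ∃[ i ] i < j × s i ≡ s j

  abstract
    firstRepeat : ∃[ N ] Repeats N × (∀ k → Repeats k → N ≤ k)
    firstRepeat =
      -- The indices from 0 to `n` are one more than the vertices.
      let i , j , i<j , eq = pigeonhole (n<1+n n) (s ∘ toℕ)
      in  least (λ j → anyUpTo? (λ i → s i ≟ᶠ s j) j) {toℕ j} (toℕ i , i<j , eq)

  N : ℕ
  N = proj₁ firstRepeat

  s-≢ : ∀ {i j} → i < j → j < N → s i ≢ s j
  s-≢ i<j j<N eq = <⇒≱ j<N (proj₂ (proj₂ firstRepeat) _ (_ , i<j , eq))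

  s-injective : ∀ {i j} → i < N → j < N → s i ≡ s j → i ≡ j
  s-injective {i} {j} i<N j<N eq with <-cmp i j
  ... | tri< i<j _ _ = contradiction eq (s-≢ i<j j<N)
  ... | tri≈ _ i≡j _ = i≡j
  ... | tri> _ _ j<i = contradiction (sym eq) (s-≢ j<i i<N)

  -- Stated for a variable `m` in place of `N`, so that it can be matched as a successor.
  s-closes : ∀ {m} → (∀ {i j} → i < j → j < m → s i ≢ s j) → Repeats m → s 0 ≡ s m
  s-closes _ (zero , _ , eq) = eq
  -- The vertex `s m` is adjacent to the repeated vertex `s (suc i)`, so it is `s i` or `s (2 + i)`.
  -- Either it repeats too early, or `suc i` is `m` and there is a loop, or `2 + i` is `m` and the
  -- walk turns back.
  s-closes {suc m} distinct (suc i , s≤s i<m , eq)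
    with s-neighbours i (subst (λ x → Adj G x (s m)) (sym eq) (adj-sym G (s-adj m)))
  ... | inj₁ sm≡si = contradiction (sym sm≡si) (distinct i<m (n<1+n m))
  ... | inj₂ sm≡s2+i with m≤n⇒m<n∨m≡n i<m
  ...   | inj₂ refl = ⊥-elim (adj-irrefl G (subst (Adj G (s m)) (sym eq) (s-adj m)))
  ...   | inj₁ 1+i<m with m≤n⇒m<n∨m≡n 1+i<m
  ...     | inj₁ 2+i<m = contradiction (sym sm≡s2+i) (distinct 2+i<m (n<1+n m))
  ...     | inj₂ refl  = contradiction (sym eq) (s-turn (suc i))

  s-N : s N ≡ s 0
  s-N = sym (s-closes s-≢ (proj₁ (proj₂ firstRepeat)))

  -- A return to `s 0` after one step would be a loop, after two steps a turn back.
  3≤N : 3 ≤ N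
  3≤N = ≮⇒≥ λ N<3 → small N N<3 (proj₁ (proj₂ firstRepeat)) s-N
    where
    small : ∀ m → m < 3 → Repeats m → s m ≢ s 0
    small 1 _ _ eq = adj-irrefl G (subst (Adj G (s 0)) eq (s-adj 0))
    small 2 _ _ eq = s-turn 0 eq
    small zero _ (_ , () , _) _
    small (suc (suc (suc m))) (s≤s (s≤s (s≤s ()))) _ _

  -- The relation `Next` on bare indices, with the modulus as a parameter so that `N` can be
  -- exchanged for `n`.
  NextModulo : ℕ → ℕ → ℕ → Set
  NextModulo m i j = j ≡ suc i ⊎ (suc i ≡ m × j ≡ 0)

  CyclicNext : ℕ → ℕ → Set
  CyclicNext = NextModulo N

  cyclicNext-adj : ∀ {i j} → CyclicNext i j → Adj G (s i) (s j)
  cyclicNext-adj {i} (inj₁ refl)          = s-adj i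
  cyclicNext-adj {i} (inj₂ (1+i≡N , refl)) =
    subst (Adj G (s i)) (trans (cong s 1+i≡N) s-N) (s-adj i)

  s-neighbour : ∀ j {x} → j < N → Adj G (s j) x →
                ∃[ k ] k < N × s k ≡ x × (CyclicNext j k ⊎ CyclicNext k j)
  s-neighbour (suc j) 1+j<N a with s-neighbours j a
  ... | inj₁ refl = j , <⇒≤ 1+j<N , refl , inj₂ (inj₁ refl)
  ... | inj₂ refl with m≤n⇒m<n∨m≡n 1+j<N
  ...   | inj₁ 2+j<N = 2 + j , 2+j<N , refl , inj₁ (inj₁ refl)
  ...   | inj₂ 2+j≡N = 0 , ≤-trans z<s 3≤N , sym (trans (cong s 2+j≡N) s-N) , inj₁ (inj₂ (2+j≡N , refl))
  -- Here `s 0` is read as `s N` with `N` equal to `suc m`, so its neighbours are `s m` and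
  -- `s (2 + m)`. The latter is `s 1`, a neighbour of `s 0` that differs from `s m` because `1 < m`.
  s-neighbour zero {x} 0<N a = around (suc-pred N {{>-nonZero 0<N}})
    where
    around : ∀ {m} → suc m ≡ N → ∃[ k ] k < N × s k ≡ x × (CyclicNext 0 k ⊎ CyclicNext k 0)
    around {m} eq = pick (neighbour a) (neighbour (s-adj 0))
      where
      m<N : m < N
      m<N = ≤-reflexive eq
      1<m : 1 < m
      1<m = ≤-pred (subst (3 ≤_) (sym eq) 3≤N)
      neighbour : ∀ {y} → Adj G (s 0) y → y ≡ s m ⊎ y ≡ s (2 + m)
      neighbour b = s-neighbours m (subst (λ z → Adj G z _) (trans (sym s-N) (cong s (sym eq))) b)
      pick : x ≡ s m ⊎ x ≡ s (2 + m) → s 1 ≡ s m ⊎ s 1 ≡ s (2 + m) → _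
      pick (inj₁ x≡) _         = m , m<N , sym x≡ , inj₂ (inj₂ (eq , refl))
      pick (inj₂ x≡) (inj₂ 1≡) = 1 , ≤-trans (s≤s z<s) 3≤N , trans 1≡ (sym x≡) , inj₁ (inj₁ refl)
      pick (inj₂ _)  (inj₁ 1≡) = contradiction 1≡ (s-≢ 1<m m<N)

  s-surjective : ∀ v → ∃[ k ] k < N × s k ≡ v
  s-surjective v = closed⇒reachable {G = G} {P = λ v → ∃[ k ] k < N × s k ≡ v}
    (λ { a (k , k<N , refl) → let j , j<N , eq , _ = s-neighbour k k<N a in j , j<N , eq })
    (proj₂ (c v₀ v)) (0 , ≤-trans z<s 3≤N , refl)

  position : Fin n → ℕ
  position v = proj₁ (s-surjective v)

  position<N : ∀ v → position v < N
  position<N v = proj₁ (proj₂ (s-surjective v))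

  s-position : ∀ v → s (position v) ≡ v
  s-position v = proj₂ (proj₂ (s-surjective v))

  N≡n : N ≡ n
  N≡n = ≤-antisym
    (injective⇒≤ {f = λ (i : Fin N) → s (toℕ i)} λ {i} {j} eq →
      toℕ-injective (s-injective (toℕ<n i) (toℕ<n j) eq))
    (injective⇒≤ {f = λ v → fromℕ< (position<N v)} λ {u} {v} eq →
      trans (sym (s-position u)) (trans (cong s (begin
        position u                    ≡⟨ toℕ-fromℕ< (position<N u) ⟨
        toℕ (fromℕ< (position<N u))   ≡⟨ cong toℕ eq ⟩
        toℕ (fromℕ< (position<N v))   ≡⟨ toℕ-fromℕ< (position<N v) ⟩
        position v                    ∎)) (s-position v)))
    where open ≡-Reasoning

  index : Fin n → Fin n
  index v = fromℕ< (subst (position v <_) N≡n (position<N v))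

  toℕ-index : ∀ v → toℕ (index v) ≡ position v
  toℕ-index v = toℕ-fromℕ< _

  position-s : ∀ {k} → k < N → position (s k) ≡ k
  position-s k<N = s-injective (position<N _) k<N (s-position _)

  -- `Next` unfolds to `NextModulo n` on the values of `toℕ`, so only the modulus and the two
  -- indices are rewritten.
  cyclicNext≡next : ∀ u v → CyclicNext (position u) (position v) ≡ Next (index u) (index v)
  cyclicNext≡next u v = trans
    (cong (λ m → NextModulo m (position u) (position v)) N≡n)
    (cong₂ (NextModulo n) (sym (toℕ-index u)) (sym (toℕ-index v)))

  isCycle : IsCycle G
  isCycle = subst (3 ≤_) N≡n 3≤N ,
    mk↔ₛ′ index (s ∘ toℕ)
      (λ i → toℕ-injective (trans (toℕ-index _) (position-s (subst (toℕ i <_) (sym N≡n) (toℕ<n i)))))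
      (λ v → trans (cong s (toℕ-index v)) (s-position v)) ,
    λ u v → mk⇔ (adj⇒ u v) (⇒adj u v)
    where
    adj⇒ : ∀ u v → Adj G u v → Adj (C n) (index u) (index v)
    adj⇒ u v a =
      (λ eq → adj-irrefl G (subst (Adj G u) (sym (index-injective eq)) a)) , nexts
      where
      index-injective : index u ≡ index v → u ≡ v
      index-injective eq = trans (sym (s-position u)) (trans
        (cong s (trans (sym (toℕ-index u)) (trans (cong toℕ eq) (toℕ-index v)))) (s-position v))
      nexts : Next (index u) (index v) ⊎ Next (index v) (index u)
      nexts with s-neighbour (position u) (position<N u) (subst (λ x → Adj G x v) (sym (s-position u)) a)
      ... | k , k<N , refl , inj₁ cn = inj₁ (subst id (cyclicNext≡next u v)
        (subst (CyclicNext (position u)) (sym (position-s k<N)) cn))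
      ... | k , k<N , refl , inj₂ cn = inj₂ (subst id (cyclicNext≡next v u)
        (subst (λ p → CyclicNext p (position u)) (sym (position-s k<N)) cn))

    ⇒adj : ∀ u v → Adj (C n) (index u) (index v) → Adj G u v
    ⇒adj u v (_ , nexts) = subst₂ (Adj G) (s-position u) (s-position v)
      ([ cyclicNext-adj ∘ subst id (sym (cyclicNext≡next u v))
      , adj-sym G ∘ cyclicNext-adj ∘ subst id (sym (cyclicNext≡next v u)) ]′ nexts)

𝒟-≡⇒cycle : ∀ {n} {G : Graph (Fin n)} (cG : Connected G) (cC : Connected (C n ^ᵍ 1)) →
            κ-Connected 2 G → 𝒟 ⟨ G , cG ⟩ ≡ 𝒟 ⟨ C n ^ᵍ 1 , cC ⟩ → IsCycle G
𝒟-≡⇒cycle {n} {G} cG cC κ-conn eq =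
  TwoRegular.isCycle cG (fromℕ< (≤-trans z<s 3≤n)) λ u →
    suc-injective (trans (degree-ball G cG u)
      -- The totals at radius one agree and every ball of `G` has at least three vertices, so none
      -- has more.
      (≤-antisym (sum-squeeze ball-≥3 total-≤ u) (ball-≥3 u)))
  where
  3≤n : 3 ≤ n
  3≤n = proj₁ κ-conn

  ball-≥3 : ∀ u → 3 ≤ ball G cG u 1
  ball-≥3 u = ≤-trans (⊓-glb 3≤n ≤-refl) (ball-≥ G cG κ-conn u 1)

  total-≤ : total G cG 1 ≤ ∑[ u < n ] 3
  total-≤ = ≤-trans (≤-reflexive (𝒟-≡⇒total-≡ cG cC eq 1))
    (sum-mono-≤ λ u → ≤-trans (ball-C^-≤ {k = 1} cC u 1) (m⊓n≤n n 3))

-- Comparison of indices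

-- With `S` one of `_≤ᴿ_`, `_<ᴿ_` and their converses, one argument serves all four kinds of index.
module _ (S : Rel ℝ 0ℓ) (S-trans : Transitive S) (I : Index) (g : List ℕ⁺ → ℝ)
         (I≃g : I ExpressedBy g) (g-mono : InEveryCoordinate _<⁺_ S g)
         (G H : ConnectedGraph) (G≤H : Pointwise _≤⁺_ (𝒟 G) (𝒟 H)) where

  𝒟-≡⇒≃ : 𝒟 G ≡ 𝒟 H → I G ≃ᴿ I H
  𝒟-≡⇒≃ eq = ≃ᴿ-trans {I G} {g (𝒟 G)} {I H} (I≃g G)
    (subst (λ xs → g xs ≃ᴿ I H) (sym eq) (≃ᴿ-sym {I H} {g (𝒟 H)} (I≃g H)))

  index-≤ : (∀ {x y} → S x y → x ≤ᴿ y) → I G ≤ᴿ I H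
  index-≤ S⇒≤ with ≡⊎monotone S S-trans g g-mono G≤H
  ... | inj₁ eq = proj₁ (𝒟-≡⇒≃ eq)
  ... | inj₂ r  = λ q → proj₂ (I≃g H) q ∘ S⇒≤ r q ∘ proj₁ (I≃g G) q

  index-≥ : (∀ {x y} → S x y → x ≥ᴿ y) → I G ≥ᴿ I H
  index-≥ S⇒≥ with ≡⊎monotone S S-trans g g-mono G≤H
  ... | inj₁ eq = proj₂ (𝒟-≡⇒≃ eq)
  ... | inj₂ r  = λ q → proj₂ (I≃g G) q ∘ S⇒≥ r q ∘ proj₁ (I≃g H) q

  -- A differing coordinate would put the two values of `g` in the relation `S`, which excludes
  -- their equality.
  ≃⇒𝒟-≡ : (∀ {x y} → S x y → ¬ (x ≃ᴿ y)) → I G ≃ᴿ I H → 𝒟 G ≡ 𝒟 H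
  ≃⇒𝒟-≡ S⇒≄ IG≃IH with ≡⊎monotone S S-trans g g-mono G≤H
  ... | inj₁ eq = eq
  ... | inj₂ r  = ⊥-elim (S⇒≄ r
    (≃ᴿ-trans {g (𝒟 G)} {I G} {g (𝒟 H)} (≃ᴿ-sym {I G} {g (𝒟 G)} (I≃g G))
      (≃ᴿ-trans {I G} {I H} {g (𝒟 H)} IG≃IH (I≃g H))))

theorem2 :
    (κ : ℕ) .{{_ : NonZero κ}} (2∣κ : 2 ∣ κ)
    (n : ℕ) (G : Graph (Fin n)) (κ-conn : κ-Connected κ G) →
    let G′ = ⟨ G , κ-connected⇒connected (>-nonZero⁻¹ κ) κ-conn ⟩
        C′ = ⟨ C n ^ᵍ (κ / 2) , C^-connected n 2∣κ ⟩
    in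
      (∀ I → Nondecreasing I → I G′ ≤ᴿ I C′)
    × (κ ≡ 2 → ∀ I → Increasing I → I G′ ≤ᴿ I C′ × (I G′ ≃ᴿ I C′ ⇔ IsCycle G))
    × (∀ I → Nonincreasing I → I G′ ≥ᴿ I C′)
    × (κ ≡ 2 → ∀ I → Decreasing I → I G′ ≥ᴿ I C′ × (I G′ ≃ᴿ I C′ ⇔ IsCycle G))
theorem2 κ 2∣κ n G κ-conn =
    (λ { I (g , I≃g , mono) →
         index-≤ _≤ᴿ_ (λ {x y z} → ≤ᴿ-trans {x} {y} {z}) I g I≃g
           -- A strict change of an entry is also a weak one, so weak monotonicity fits the form
           -- stated with `_<⁺_`.
           (λ xs ys {a} {b} → mono xs ys {a} {b} ∘ <⇒≤) G′ C′ G≤C id })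
  , (λ { κ≡2 I (g , I≃g , mono) →
         index-≤ _<ᴿ_ (λ {x y z} → <ᴿ-trans {x} {y} {z}) I g I≃g mono G′ C′ G≤C
           (λ {x} {y} → <ᴿ⇒≤ᴿ {x} {y})
       , equality _<ᴿ_ (λ {x y z} → <ᴿ-trans {x} {y} {z}) κ≡2 I g I≃g mono
           (λ {x} {y} x<y (_ , y≤x) → <ᴿ⇒≱ᴿ {x} {y} x<y y≤x) })
  , (λ { I (g , I≃g , mono) →
         index-≥ _≥ᴿ_ (λ {x y z} → flip (≤ᴿ-trans {z} {y} {x})) I g I≃g
           (λ xs ys {a} {b} → mono xs ys {a} {b} ∘ <⇒≤) G′ C′ G≤C id })
  , (λ { κ≡2 I (g , I≃g , mono) →
         index-≥ _>ᴿ_ (λ {x y z} → flip (<ᴿ-trans {z} {y} {x})) I g I≃g mono G′ C′ G≤C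
           (λ {x} {y} → <ᴿ⇒≤ᴿ {y} {x})
       , equality _>ᴿ_ (λ {x y z} → flip (<ᴿ-trans {z} {y} {x})) κ≡2 I g I≃g mono
           (λ {x} {y} y<x (x≤y , _) → <ᴿ⇒≱ᴿ {y} {x} y<x x≤y) })
  where
  G′ C′ : ConnectedGraph
  G′ = ⟨ G , κ-connected⇒connected (>-nonZero⁻¹ κ) κ-conn ⟩
  C′ = ⟨ C n ^ᵍ (κ / 2) , C^-connected n 2∣κ ⟩

  G≤C : Pointwise _≤⁺_ (𝒟 G′) (𝒟 C′)
  G≤C = κ-connected-𝒟-≤ (κ / 2) (connected G′) (connected C′)
          (subst (λ k → κ-Connected k G) (sym (m/n*n≡m 2∣κ)) κ-conn)

  cycle⇔ : κ ≡ 2 → 𝒟 G′ ≡ 𝒟 C′ ⇔ IsCycle G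
  -- Matching on `refl` lets `κ / 2` compute to 1.
  cycle⇔ refl = mk⇔ (𝒟-≡⇒cycle (connected G′) (connected C′) κ-conn)
    λ (_ , iso) → pointwise-antisym G≤C (cycle-𝒟-≥ (connected G′) (connected C′) iso)

  equality : (S : Rel ℝ 0ℓ) → Transitive S → κ ≡ 2 → ∀ I g → I ExpressedBy g →
             InEveryCoordinate _<⁺_ S g → (∀ {x y} → S x y → ¬ (x ≃ᴿ y)) →
             I G′ ≃ᴿ I C′ ⇔ IsCycle G
  equality S S-trans κ≡2 I g I≃g mono S⇒≄ = mk⇔
    (Equivalence.to (cycle⇔ κ≡2) ∘ ≃⇒𝒟-≡ S S-trans I g I≃g mono G′ C′ G≤C S⇒≄)
    (𝒟-≡⇒≃ S S-trans I g I≃g mono G′ C′ G≤C ∘ Equivalence.from (cycle⇔ κ≡2))
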